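{- There exists a balanced group divisible triangle design $(V,\mathcal{G},\mathcal{B})$ of order $12$ with groups of dimension $6$ over $\mathbb{F}_2$, where $V=\mathbb{F}_{2^{12}}$, $\mathcal{G}$ is the set of all $65$ one-dimensional $\mathbb{F}_{2^6}$-subspaces of $V$ (each a $6$-dimensional $\mathbb{F}_2$-subspace; i.e. the Desarguesian spread), and $\mathcal{B}$ is invariant under multiplication by elements of $\mathbb{F}_{2^{12}}^*$.
   Context: For a vector space $V$ over $\mathbb{F}_q$, a triangle is a set $\{\langle a,b\rangle,\langle b,c\rangle,\langle c,a\rangle\}$ of three $2$-dimensional subspaces, with $a,b,c$ linearly independent. For $m\mid n$, a group divisible triangle design of order $n$ with groups of dimension $m$ over $\mathbb{F}_q$ is a triple $(V,\mathcal{G},\mathcal{B})$: $V$ an $n$-dimensional $\mathbb{F}_q$-space, $\mathcal{G}$ a set of $m$-dimensional subspaces such that every nonzero vector lies in exactly one, and $\mathcal{B}$ a set of triangles such that every $2$-dimensional subspace either belongs to exactly one triangle of $\mathcal{B}$ and to no group, or to no triangle and to one group. A triangle covers a nonzero vector $x$ if $x$ lies in one of its three subspaces; the design is balanced if all nonzero vectors are covered by the same number of triangles of $\mathcal{B}$. -}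

module Defs where

open import Data.Nat using (ℕ; zero; suc)
open import Data.Bool using (Bool; true; false; _xor_; _∧_; if_then_else_)
open import Data.Vec using (Vec; []; _∷_; replicate; zipWith; map; init; last)
import Data.Vec.Properties as VecP
import Data.Bool.Properties as BoolP
open import Data.List using (List; length; lookup; filter)
open import Data.List.Relation.Unary.All using (All)
open import Data.Fin using (Fin)
open import Data.Product using (Σ; _×_; _,_)
open import Data.Sum using (_⊎_; inj₁; inj₂)
open import Relation.Nullary using (¬_; Dec; yes; no)
open import Relation.Binary.PropositionalEquality using (_≡_; _≢_)

V : ℕ → Set
V n = Vec Bool n

0V : ∀ {n} → V n
0V = replicate _ false

infixl 6 _+V_
_+V_ : ∀ {n} → V n → V n → V n
_+V_ = zipWith _xor_

_•_ : ∀ {n} → Bool → V n → V n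
μ • v = map (μ ∧_) v

_≟V_ : ∀ {n} (x y : V n) → Dec (x ≡ y)
_≟V_ = VecP.≡-dec BoolP._≟_

lincomb : ∀ {n m} → Vec Bool m → Vec (V n) m → V n
lincomb []       []       = 0V
lincomb (c ∷ cs) (e ∷ es) = (c • e) +V lincomb cs es

Independent : ∀ {n m} → Vec (V n) m → Set
Independent {m = m} e = (c : Vec Bool m) → lincomb c e ≡ 0V → c ≡ replicate m false

InSpan : ∀ {n m} → Vec (V n) m → V n → Set
InSpan {m = m} e x = Σ (Vec Bool m) λ c → x ≡ lincomb c e

Pred : ℕ → Set₁
Pred n = V n → Set

_⊆_ : ∀ {n} → Pred n → Pred n → Set
S ⊆ T = ∀ x → S x → T x

_≐_ : ∀ {n} → Pred n → Pred n → Set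
S ≐ T = S ⊆ T × T ⊆ S

HasDim : ∀ {n} → ℕ → Pred n → Set
HasDim {n} m S = Σ (Vec (V n) m) λ e → Independent e × (S ≐ InSpan e)

⟨_,_⟩ : ∀ {n} → V n → V n → Pred n
⟨ a , b ⟩ = InSpan (a ∷ b ∷ [])

-- a triangle is given by three vectors a b c (required to be independent);
-- as a set it is {⟨a,b⟩, ⟨b,c⟩, ⟨c,a⟩}
record Tri (n : ℕ) : Set where
  constructor tri
  field a b c : V n
open Tri public

TriIndependent : ∀ {n} → Tri n → Set
TriIndependent T = Independent (a T ∷ b T ∷ c T ∷ [])

HasSide : ∀ {n} → Tri n → Pred n → Set
HasSide T S = (⟨ a T , b T ⟩ ≐ S) ⊎ (⟨ b T , c T ⟩ ≐ S) ⊎ (⟨ c T , a T ⟩ ≐ S)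

_≈T_ : ∀ {n} → Tri n → Tri n → Set
T ≈T T' = (HasSide T' ⟨ a T , b T ⟩ × HasSide T' ⟨ b T , c T ⟩ × HasSide T' ⟨ c T , a T ⟩)
        × (HasSide T ⟨ a T' , b T' ⟩ × HasSide T ⟨ b T' , c T' ⟩ × HasSide T ⟨ c T' , a T' ⟩)

Covers : ∀ {n} → Tri n → V n → Set
Covers T x = ⟨ a T , b T ⟩ x ⊎ ⟨ b T , c T ⟩ x ⊎ ⟨ c T , a T ⟩ x

∃Vec? : ∀ m {P : Vec Bool m → Set} → (∀ c → Dec (P c)) → Dec (Σ (Vec Bool m) P)
∃Vec? zero P? with P? []
... | yes p = yes ([] , p)
... | no ¬p = no λ { ([] , p) → ¬p p }
∃Vec? (suc m) P? with ∃Vec? m (λ c → P? (false ∷ c)) | ∃Vec? m (λ c → P? (true ∷ c))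
... | yes (c , p) | _ = yes (false ∷ c , p)
... | no _ | yes (c , p) = yes (true ∷ c , p)
... | no f | no t = no λ { (false ∷ c , p) → f (c , p) ; (true ∷ c , p) → t (c , p) }

inSpan? : ∀ {n m} (e : Vec (V n) m) (x : V n) → Dec (InSpan e x)
inSpan? {m = m} e x = ∃Vec? m (λ c → x ≟V lincomb c e)

_⊎?_ : ∀ {A B : Set} → Dec A → Dec B → Dec (A ⊎ B)
yes p ⊎? _ = yes (inj₁ p)
no _ ⊎? yes q = yes (inj₂ q)
no f ⊎? no g = no λ { (inj₁ p) → f p ; (inj₂ q) → g q }

covers? : ∀ {n} (x : V n) (T : Tri n) → Dec (Covers T x)
covers? x T = inSpan? (a T ∷ b T ∷ []) x ⊎? (inSpan? (b T ∷ c T ∷ []) x ⊎? inSpan? (c T ∷ a T ∷ []) x)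

coverCount : ∀ {n} → List (Tri n) → V n → ℕ
coverCount B x = length (filter (covers? x) B)

-- Group divisible triangle designs.
-- Groups are given as an indexed family G : I → Pred n (the set 𝒢 is its
-- image); blocks as a list B whose positions are the triangles of ℬ.

ExactlyOneTri : ∀ {n} → List (Tri n) → Pred n → Set
ExactlyOneTri B S =
  Σ (Fin (length B)) λ i → HasSide (lookup B i) S
    × (∀ j → HasSide (lookup B j) S → j ≡ i)

NoTri : ∀ {n} → List (Tri n) → Pred n → Set
NoTri B S = ∀ i → ¬ HasSide (lookup B i) S

record IsGDTD (n m : ℕ) {I : Set} (G : I → Pred n) (B : List (Tri n)) : Set₁ where
  field
    groupDim   : ∀ i → HasDim m (G i)
    partition  : ∀ (x : V n) → x ≢ 0V →
                   Σ I (λ i → G i x) × (∀ i j → G i x → G j x → G i ≐ G j)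
    triangles  : All TriIndependent B
    twoSpaces  : ∀ (x y : V n) → Independent (x ∷ y ∷ []) →
                   (ExactlyOneTri B ⟨ x , y ⟩ × (∀ i → ¬ (⟨ x , y ⟩ ⊆ G i)))
                 ⊎ (NoTri B ⟨ x , y ⟩ × Σ I (λ i → ⟨ x , y ⟩ ⊆ G i))

Balanced : ∀ {n} → List (Tri n) → Set
Balanced {n} B = Σ ℕ λ r → ∀ (x : V n) → x ≢ 0V → coverCount B x ≡ r

-- The field F_{2^12} = F₂[X]/(X¹² + X⁶ + X⁴ + X + 1)
-- (this polynomial is irreducible over F₂).  An element is its coefficient
-- vector, index i = coefficient of Xⁱ.

F : Set
F = V 12

-- X¹² ≡ 1 + X + X⁴ + X⁶
redPoly : F
redPoly = true ∷ true ∷ false ∷ false ∷ true ∷ false ∷ true ∷ false ∷ false ∷ false ∷ false ∷ false ∷ []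

mulX : F → F
mulX v = (false ∷ init v) +V (if last v then redPoly else 0V)

mulAux : ∀ {k} → F → Vec Bool k → F
mulAux a []       = 0V
mulAux a (β ∷ bs) = (β • a) +V mulAux (mulX a) bs

infixl 7 _·_
_·_ : F → F → F
x · y = mulAux x y

1F : F
1F = true ∷ replicate 11 false

_^_ : F → ℕ → F
x ^ zero  = 1F
x ^ suc k = x · (x ^ k)

InSubfield64 : F → Set
InSubfield64 l = l ^ 64 ≡ l

NonZeroF : Set
NonZeroF = Σ F λ y → y ≢ 0V

DesGroup : NonZeroF → Pred 12
DesGroup (y , _) x = Σ F λ l → InSubfield64 l × x ≡ l · y

scaleTri : F → Tri 12 → Tri 12
scaleTri g T = tri (g · a T) (g · b T) (g · c T)

MulInvariant : List (Tri 12) → Set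
MulInvariant B = ∀ (g : F) → g ≢ 0V →
    (∀ i → Σ (Fin (length B)) λ j → lookup B j ≈T scaleTri g (lookup B i))
  × (∀ j → Σ (Fin (length B)) λ i → lookup B j ≈T scaleTri g (lookup B i))

{-# OPTIONS --safe #-}

-- A 2-space ⟨x, y⟩ of the field F of 2¹² elements is determined up to
-- multiplication by F* by the ratio y/x, where the six ordered bases (x, y) give
-- six ratios; it lies in a group exactly when these ratios are in 𝔽₆₄.  So it is
-- enough to find a set of base triangles such that, among the 18 ratios coming
-- from the ordered bases of the three sides of each of them, every element of
-- F ∖ 𝔽₆₄ occurs exactly once: 4032 = 224 · 18 ratios.  The multiples g T of the
-- base triangles T by g ∈ F* are then the blocks.  Uniqueness of T and of the
-- ordered basis (p, q) with q/p = y/x also makes g = x/p unique.  Balancedness is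
-- automatic since F* permutes the blocks and is transitive on nonzero vectors.

module Submission where

open import Defs
open import Algebra.Bundles using (CommutativeSemigroup)
open import Algebra.Definitions using (Associative; Commutative; LeftIdentity; RightIdentity)
import Algebra.Properties.CommutativeSemigroup as CommutativeSemigroupProperties
open import Data.Bool using (Bool; true; false; _xor_; if_then_else_)
import Data.Bool.Properties as Bool
open import Data.Fin using (Fin; zero; suc)
import Data.Fin.Properties as Fin
open import Data.List
  using (List; []; _∷_; _++_; cartesianProduct; concatMap; filter; iterate; length; lookup; reverse; zip)
import Data.List as List
open import Data.List.Membership.Propositional using (_∈_) renaming (find to ∈-find)
open import Data.List.Membership.Propositional.Properties
  using (∈-++⁺ˡ; ∈-++⁺ʳ; ∈-++⁻; ∈-cartesianProduct⁺; ∈-cartesianProduct⁻; ∈-concatMap⁺; ∈-concatMap⁻;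
         ∈-filter⁺; ∈-filter⁻; ∈-lookup; ∈-map⁺; ∈-map⁻)
open import Data.List.Membership.Propositional.Properties.WithK using (unique∧set⇒bag)
import Data.List.Properties as ListProperties
open import Data.List.Relation.Binary.BagAndSetEquality using (∼bag⇒↭)
open import Data.List.Relation.Binary.Disjoint.Propositional using (Disjoint)
open import Data.List.Relation.Binary.Permutation.Propositional using (_↭_)
open import Data.List.Relation.Binary.Permutation.Propositional.Properties
  using (filter-↭; ↭-length) renaming (map⁺ to ↭-map⁺)
open import Data.List.Relation.Unary.All as All using (All; []; _∷_)
open import Data.List.Relation.Unary.Any as Any using (here; there)
open import Data.List.Relation.Unary.Any.Properties using (lookup-index)
open import Data.List.Relation.Unary.Unique.DecPropositional using (unique?)
open import Data.List.Relation.Unary.Unique.Propositional using (Unique; []; _∷_)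
import Data.List.Relation.Unary.Unique.Propositional.Properties as Unique
open import Data.Maybe using (Maybe; just; nothing; fromMaybe)
import Data.Maybe.Properties as Maybe
open import Data.Nat using (ℕ; zero; suc; _+_; _≡ᵇ_)
open import Data.Nat.DivMod using (_/_; _%_)
open import Data.Product using (Σ; ∃; _×_; _,_; proj₁; proj₂)
import Data.Product.Properties as Product
open import Data.Sum as Sum using (_⊎_; inj₁; inj₂)
open import Data.Vec using (Vec; []; _∷_; init; last; map; replicate)
import Data.Vec.Properties as Vec
open import Function using (_∘_; mk⇔)
open import Relation.Binary.Definitions using (DecidableEquality)
open import Relation.Binary.PropositionalEquality
open import Relation.Nullary using (¬_; Dec; yes; no; contradiction)
open import Relation.Nullary.Decidable using (_×-dec_; _⊎-dec_; _→-dec_; ¬?; from-yes; map′)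

open ≡-Reasoning

-- Linear algebra over 𝔽₂

+V-assoc : ∀ {n} → Associative _≡_ (_+V_ {n})
+V-assoc = Vec.zipWith-assoc Bool.xor-assoc

+V-comm : ∀ {n} → Commutative _≡_ (_+V_ {n})
+V-comm = Vec.zipWith-comm Bool.xor-comm

+V-identityˡ : ∀ {n} → LeftIdentity _≡_ 0V (_+V_ {n})
+V-identityˡ = Vec.zipWith-identityˡ Bool.xor-identityˡ

+V-identityʳ : ∀ {n} → RightIdentity _≡_ 0V (_+V_ {n})
+V-identityʳ = Vec.zipWith-identityʳ Bool.xor-identityʳ

+V-self : ∀ {n} (v : V n) → v +V v ≡ 0V
+V-self []      = refl
+V-self (x ∷ v) = cong₂ _∷_ (Bool.xor-same x) (+V-self v)

+V-cancel : ∀ {n} (v w : V n) → v +V (v +V w) ≡ w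
+V-cancel v w = begin
  v +V (v +V w)  ≡⟨ +V-assoc v v w ⟨
  v +V v +V w    ≡⟨ cong (_+V w) (+V-self v) ⟩
  0V +V w        ≡⟨ +V-identityˡ w ⟩
  w              ∎

+V-≡0 : ∀ {n} {v w : V n} → v +V w ≡ 0V → v ≡ w
+V-≡0 {v = v} {w} eq = begin
  v              ≡⟨ +V-identityʳ v ⟨
  v +V 0V        ≡⟨ cong (v +V_) eq ⟨
  v +V (v +V w)  ≡⟨ +V-cancel v w ⟩
  w              ∎

+V-commutativeSemigroup : ℕ → CommutativeSemigroup _ _
+V-commutativeSemigroup n = record
  { _∙_ = _+V_ {n}
  ; isCommutativeSemigroup = record
    { isSemigroup = record
      { isMagma = record { isEquivalence = isEquivalence ; ∙-cong = cong₂ _+V_ }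
      ; assoc = +V-assoc }
    ; comm = +V-comm } }

module +V {n} = CommutativeSemigroupProperties (+V-commutativeSemigroup n)

true• : ∀ {n} (v : V n) → true • v ≡ v
true• = Vec.map-id

false• : ∀ {n} (v : V n) → false • v ≡ 0V
false• v = Vec.map-const v false

•-distribʳ : ∀ {n} μ ν (v : V n) → (μ xor ν) • v ≡ (μ • v) +V (ν • v)
•-distribʳ false ν     v = sym (trans (cong (_+V (ν • v)) (false• v)) (+V-identityˡ _))
•-distribʳ true  false v = sym (trans (cong ((true • v) +V_) (false• v)) (+V-identityʳ _))
•-distribʳ true  true  v = trans (false• v) (sym (+V-self _))

-- Over 𝔽₂ these are the linear maps: the only scalars are 0 and 1, and `additive-•` and
-- `additive-lincomb` recover compatibility with them.
Additive : ∀ {n m} → (V n → V m) → Set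
Additive f = ∀ v w → f (v +V w) ≡ f v +V f w

module _ {n m} {f : V n → V m} (f-+ : Additive f) where

  additive-0 : f 0V ≡ 0V
  additive-0 = begin
    f 0V            ≡⟨ cong f (+V-self 0V) ⟨
    f (0V +V 0V)    ≡⟨ f-+ 0V 0V ⟩
    f 0V +V f 0V    ≡⟨ +V-self (f 0V) ⟩
    0V              ∎

  additive-• : ∀ μ v → f (μ • v) ≡ μ • f v
  additive-• false v = trans (cong f (false• v)) (trans additive-0 (sym (false• (f v))))
  additive-• true  v = trans (cong f (true• v)) (sym (true• (f v)))

  additive-lincomb : ∀ {k} (c : Vec Bool k) e → f (lincomb c e) ≡ lincomb c (map f e)
  additive-lincomb []      []      = additive-0
  additive-lincomb (μ ∷ c) (v ∷ e) = begin
    f ((μ • v) +V lincomb c e)        ≡⟨ f-+ _ _ ⟩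
    f (μ • v) +V f (lincomb c e)      ≡⟨ cong₂ _+V_ (additive-• μ v) (additive-lincomb c e) ⟩
    (μ • f v) +V lincomb c (map f e)  ∎

•-distribˡ : ∀ {n} μ → Additive {n} (μ •_)
•-distribˡ false v w = trans (false• _) (sym (trans (cong₂ _+V_ (false• v) (false• w)) (+V-self 0V)))
•-distribˡ true  v w = trans (true• _) (sym (cong₂ _+V_ (true• v) (true• w)))

∘-additive : ∀ {n m k} {f : V m → V k} {g : V n → V m} → Additive f → Additive g → Additive (λ v → f (g v))
∘-additive {f = f} f-+ g-+ v w = trans (cong f (g-+ v w)) (f-+ _ _)

+-additive : ∀ {n m} {f g : V n → V m} → Additive f → Additive g → Additive (λ v → f v +V g v)
+-additive {f = f} {g} f-+ g-+ v w =
  trans (cong₂ _+V_ (f-+ v w) (g-+ v w)) (+V.interchange (f v) (f w) (g v) (g w))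

lincomb-+ : ∀ {n k} (e : Vec (V n) k) → Additive (λ c → lincomb c e)
lincomb-+ []      []      []      = sym (+V-self 0V)
lincomb-+ (v ∷ e) (μ ∷ c) (ν ∷ d) = begin
  ((μ xor ν) • v) +V lincomb (c +V d) e                      ≡⟨ cong₂ _+V_ (•-distribʳ μ ν v) (lincomb-+ e c d) ⟩
  ((μ • v) +V (ν • v)) +V (lincomb c e +V lincomb d e)       ≡⟨ +V.interchange (μ • v) (ν • v) _ _ ⟩
  ((μ • v) +V lincomb c e) +V ((ν • v) +V lincomb d e)       ∎

unit : ∀ {n} → Fin n → V n
unit zero    = true ∷ 0V
unit (suc i) = false ∷ unit i

-- Linear maps are determined by their values on a basis. This turns an identity over all 4096
-- elements of `F` into twelve evaluations at unit vectors.
additive-ext : ∀ {n m} {f g : V n → V m} → Additive f → Additive g →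
               (∀ i → f (unit i) ≡ g (unit i)) → ∀ v → f v ≡ g v
additive-ext f-+ g-+ eq [] = trans (additive-0 f-+) (sym (additive-0 g-+))
additive-ext {f = f} {g} f-+ g-+ eq (b ∷ v) = begin
  f (b ∷ v)                               ≡⟨ cong f split ⟩
  f ((b • unit zero) +V (false ∷ v))      ≡⟨ f-+ _ _ ⟩
  f (b • unit zero) +V f (false ∷ v)      ≡⟨ cong₂ _+V_ first rest ⟩
  g (b • unit zero) +V g (false ∷ v)      ≡⟨ g-+ _ _ ⟨
  g ((b • unit zero) +V (false ∷ v))      ≡⟨ cong g split ⟨
  g (b ∷ v)                               ∎
  where
  split : b ∷ v ≡ (b • unit zero) +V (false ∷ v)
  split = cong₂ _∷_
    (sym (trans (Bool.xor-identityʳ _) (Bool.∧-identityʳ b)))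
    (sym (trans (cong (_+V v) (additive-0 (•-distribˡ b))) (+V-identityˡ v)))
  first : f (b • unit zero) ≡ g (b • unit zero)
  first = trans (additive-• f-+ b _) (trans (cong (b •_) (eq zero)) (sym (additive-• g-+ b _)))
  rest : f (false ∷ v) ≡ g (false ∷ v)
  rest = additive-ext (λ x y → f-+ (false ∷ x) (false ∷ y)) (λ x y → g-+ (false ∷ x) (false ∷ y))
           (λ i → eq (suc i)) v

-- The field F

init-+ : ∀ {n} → Additive {suc n} init
init-+ (x ∷ [])     (y ∷ [])     = refl
init-+ (x ∷ v@(_ ∷ _)) (y ∷ w@(_ ∷ _)) = cong ((x xor y) ∷_) (init-+ v w)

last-+ : ∀ {n} (v w : V (suc n)) → last (v +V w) ≡ last v xor last w
last-+ (x ∷ [])     (y ∷ [])     = refl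
last-+ (x ∷ v@(_ ∷ _)) (y ∷ w@(_ ∷ _)) = last-+ v w

if-• : ∀ {n} μ (v : V n) → (if μ then v else 0V) ≡ μ • v
if-• false v = sym (false• v)
if-• true  v = sym (true• v)

mulX-+ : Additive mulX
mulX-+ v w = begin
  shift (v +V w) +V carry (last (v +V w))               ≡⟨ cong₂ _+V_ (cong (false ∷_) (init-+ v w)) carries ⟩
  (shift v +V shift w) +V (carry (last v) +V carry (last w)) ≡⟨ +V.interchange (shift v) _ _ _ ⟩
  mulX v +V mulX w                                      ∎
  where
  shift : F → F
  shift v = false ∷ init v
  carry : Bool → F
  carry β = if β then redPoly else 0V
  carries : carry (last (v +V w)) ≡ carry (last v) +V carry (last w)
  carries = begin
    carry (last (v +V w))                      ≡⟨ if-• _ redPoly ⟩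
    last (v +V w) • redPoly                    ≡⟨ cong (_• redPoly) (last-+ v w) ⟩
    (last v xor last w) • redPoly              ≡⟨ •-distribʳ (last v) (last w) redPoly ⟩
    (last v • redPoly) +V (last w • redPoly)   ≡⟨ cong₂ _+V_ (if-• (last v) redPoly) (if-• (last w) redPoly) ⟨
    carry (last v) +V carry (last w)           ∎

mulAux-+ˡ : ∀ {k} (β : Vec Bool k) → Additive (λ x → mulAux x β)
mulAux-+ˡ []      x y = sym (+V-self 0V)
mulAux-+ˡ (μ ∷ β) x y = begin
  (μ • (x +V y)) +V mulAux (mulX (x +V y)) β
    ≡⟨ cong₂ _+V_ (•-distribˡ μ x y) (trans (cong (λ z → mulAux z β) (mulX-+ x y)) (mulAux-+ˡ β _ _)) ⟩
  ((μ • x) +V (μ • y)) +V (mulAux (mulX x) β +V mulAux (mulX y) β)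
    ≡⟨ +V.interchange (μ • x) _ _ _ ⟩
  mulAux x (μ ∷ β) +V mulAux y (μ ∷ β) ∎

·-distribʳ : ∀ x y z → (x +V y) · z ≡ x · z +V y · z
·-distribʳ x y z = mulAux-+ˡ z x y

-- Endomorphisms of `F` as an 𝔽₂[X]-module, X acting by `mulX`.
record XLinear (f : F → F) : Set where
  field
    additive : Additive f
    mulX-homo : ∀ x → f (mulX x) ≡ mulX (f x)

-- `mulAux x β` is the polynomial with coefficients β, evaluated at the operator `mulX` and applied
-- to x, so whatever commutes with sums and with `mulX` commutes with it.
mulAux-XLinear : ∀ {k} (β : Vec Bool k) {f} → XLinear f → ∀ x → f (mulAux x β) ≡ mulAux (f x) β
mulAux-XLinear [] f-lin x = additive-0 (XLinear.additive f-lin)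
mulAux-XLinear (μ ∷ β) {f} f-lin x = begin
  f ((μ • x) +V mulAux (mulX x) β)         ≡⟨ additive _ _ ⟩
  f (μ • x) +V f (mulAux (mulX x) β)       ≡⟨ cong₂ _+V_ (additive-• additive μ x) (mulAux-XLinear β f-lin (mulX x)) ⟩
  (μ • f x) +V mulAux (f (mulX x)) β       ≡⟨ cong (λ z → (μ • f x) +V mulAux z β) (mulX-homo x) ⟩
  (μ • f x) +V mulAux (mulX (f x)) β       ∎
  where open XLinear f-lin

mulX-XLinear : XLinear mulX
mulX-XLinear = record { additive = mulX-+ ; mulX-homo = λ _ → refl }

·-XLinear : ∀ z → XLinear (_· z)
·-XLinear z = record
  { additive = λ x y → ·-distribʳ x y z
  -- `_· z` is a polynomial in `mulX`, and `mulX` commutes with itself.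
  ; mulX-homo = λ x → sym (mulAux-XLinear z mulX-XLinear x) }

∘-XLinear : ∀ {f g} → XLinear f → XLinear g → XLinear (f ∘ g)
∘-XLinear {f} {g} f-lin g-lin = record
  { additive = λ x y → trans (cong f (additive g-lin x y)) (additive f-lin _ _)
  ; mulX-homo = λ x → trans (cong f (mulX-homo g-lin x)) (mulX-homo f-lin _) }
  where open XLinear

mulAux-+ʳ : ∀ {k} x → Additive {k} (mulAux x)
mulAux-+ʳ x []      []      = sym (+V-self 0V)
mulAux-+ʳ x (μ ∷ v) (ν ∷ w) = begin
  ((μ xor ν) • x) +V mulAux (mulX x) (v +V w)
    ≡⟨ cong₂ _+V_ (•-distribʳ μ ν x) (mulAux-+ʳ (mulX x) v w) ⟩
  ((μ • x) +V (ν • x)) +V (mulAux (mulX x) v +V mulAux (mulX x) w)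
    ≡⟨ +V.interchange (μ • x) _ _ _ ⟩
  mulAux x (μ ∷ v) +V mulAux x (ν ∷ w) ∎

·-distribˡ : ∀ x → Additive (x ·_)
·-distribˡ = mulAux-+ʳ

·-identityˡ : ∀ x → 1F · x ≡ x
·-identityˡ = additive-ext (·-distribˡ 1F) (λ _ _ → refl)
  (from-yes (Fin.all? λ i → (1F · unit i) ≟V unit i))

-- F is the cyclic F₂[X]-module generated by 1; commutativity and
-- associativity of the product both follow from this.
XLinear-· : ∀ {f} → XLinear f → ∀ x → f x ≡ f 1F · x
XLinear-· {f} f-lin x = trans (cong f (sym (·-identityˡ x))) (mulAux-XLinear x f-lin 1F)

·-comm : ∀ x y → x · y ≡ y · x
·-comm x y = trans (XLinear-· (·-XLinear y) x) (cong (_· x) (·-identityˡ y))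

·-assoc : ∀ x y z → (x · y) · z ≡ x · (y · z)
·-assoc x y z = begin
  (x · y) · z           ≡⟨ XLinear-· (∘-XLinear (·-XLinear z) (·-XLinear y)) x ⟩
  ((1F · y) · z) · x    ≡⟨ cong (λ w → (w · z) · x) (·-identityˡ y) ⟩
  (y · z) · x           ≡⟨ ·-comm (y · z) x ⟩
  x · (y · z)           ∎

·-identityʳ : ∀ x → x · 1F ≡ x
·-identityʳ x = trans (·-comm x 1F) (·-identityˡ x)

·-zeroˡ : ∀ x → 0V · x ≡ 0V
·-zeroˡ x = additive-0 (XLinear.additive (·-XLinear x))

·-zeroʳ : ∀ x → x · 0V ≡ 0V
·-zeroʳ x = additive-0 (·-distribˡ x)

·-commutativeSemigroup : CommutativeSemigroup _ _
·-commutativeSemigroup = record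
  { _∙_ = _·_
  ; isCommutativeSemigroup = record
    { isSemigroup = record
      { isMagma = record { isEquivalence = isEquivalence ; ∙-cong = cong₂ _·_ }
      ; assoc = ·-assoc }
    ; comm = ·-comm } }

module · = CommutativeSemigroupProperties ·-commutativeSemigroup

-- Finite maps keyed by bit vectors, and inverses in F

data Trie (A : Set) : ℕ → Set where
  empty : ∀ {n} → Trie A n
  leaf  : A → Trie A 0
  node  : ∀ {n} → Trie A n → Trie A n → Trie A (suc n)

module _ {A : Set} where

  find : ∀ {n} → Trie A n → Vec Bool n → Maybe A
  find empty      _           = nothing
  find (leaf x)   _           = just x
  find (node l r) (false ∷ k) = find l k
  find (node l r) (true  ∷ k) = find r k

  insert : ∀ {n} → Vec Bool n → A → Trie A n → Trie A n
  insert []          x _          = leaf x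
  insert (false ∷ k) x empty      = node (insert k x empty) empty
  insert (false ∷ k) x (node l r) = node (insert k x l) r
  insert (true  ∷ k) x empty      = node empty (insert k x empty)
  insert (true  ∷ k) x (node l r) = node l (insert k x r)

  fromList : ∀ {n} → List (Vec Bool n × A) → Trie A n
  fromList []             = empty
  fromList ((k , x) ∷ xs) = insert k x (fromList xs)

  -- Soundness of lookup: whatever comes out was put in. Inserting under a present key overwrites
  -- it, so a hit is the new pair or an old one.
  find-insert : ∀ {n} (k : Vec Bool n) x t k′ {y} → find (insert k x t) k′ ≡ just y →
                (k′ , y) ≡ (k , x) ⊎ find t k′ ≡ just y
  find-insert []          x t          []           refl = inj₁ refl
  find-insert (false ∷ k) x empty      (false ∷ k′) eq with find-insert k x empty k′ eq
  ... | inj₁ refl = inj₁ refl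
  find-insert (false ∷ k) x (node l r) (false ∷ k′) eq with find-insert k x l k′ eq
  ... | inj₁ refl = inj₁ refl
  ... | inj₂ eq′  = inj₂ eq′
  find-insert (false ∷ k) x (node l r) (true  ∷ k′) eq = inj₂ eq
  find-insert (true  ∷ k) x empty      (true  ∷ k′) eq with find-insert k x empty k′ eq
  ... | inj₁ refl = inj₁ refl
  find-insert (true  ∷ k) x (node l r) (true  ∷ k′) eq with find-insert k x r k′ eq
  ... | inj₁ refl = inj₁ refl
  ... | inj₂ eq′  = inj₂ eq′
  find-insert (true  ∷ k) x (node l r) (false ∷ k′) eq = inj₂ eq

  find-fromList : ∀ {n} (xs : List (Vec Bool n × A)) {k y} → find (fromList xs) k ≡ just y → (k , y) ∈ xs
  find-fromList ((k , x) ∷ xs) {k′} eq with find-insert k x (fromList xs) k′ eq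
  ... | inj₁ eq′ = here eq′
  ... | inj₂ eq′ = there (find-fromList xs eq′)

∀Vec? : ∀ n {P : Vec Bool n → Set} → (∀ v → Dec (P v)) → Dec (∀ v → P v)
∀Vec? zero    P? = map′ (λ { p [] → p }) (λ p → p []) (P? [])
∀Vec? (suc n) P? = map′ (λ { (p , q) (false ∷ v) → p v ; (p , q) (true ∷ v) → q v })
  (λ p → (λ v → p (false ∷ v)) , (λ v → p (true ∷ v)))
  (∀Vec? n (λ v → P? (false ∷ v)) ×-dec ∀Vec? n (λ v → P? (true ∷ v)))

bits : ∀ n → ℕ → V n
bits zero    k = []
bits (suc n) k = (k % 2 ≡ᵇ 1) ∷ bits n (k / 2)

-- The default `0V` can hide no gap in the table: x · 0V = 0 differs from 1, so `Inverses` fails at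
-- a non-zero x without an entry.
inverseIn : Trie F 12 → F → F
inverseIn t x = fromMaybe 0V (find t x)

Inverses : Trie F 12 → Set
Inverses t = ∀ x → x ≡ 0V ⊎ x · inverseIn t x ≡ 1F

inverses? : ∀ t → Dec (Inverses t)
inverses? t = ∀Vec? 12 λ x → (x ≟V 0V) ⊎-dec ((x · inverseIn t x) ≟V 1F)

-- X⁴⁰⁹⁵ = 1, so the powers X⁰, …, X⁴⁰⁹⁵ listed backwards are their inverses.
-- The definition is opaque because unfolding it in a goal rebuilds the table.
opaque
  inverseTable : Trie F 12
  inverseTable = fromList (zip powers (reverse powers))
    where
    powers : List F
    powers = iterate mulX 1F 4096

  inverseTable-correct : Inverses inverseTable
  inverseTable-correct = from-yes (inverses? inverseTable)

inv : F → F
inv = inverseIn inverseTable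

·-inverseʳ : ∀ {x} → x ≢ 0V → x · inv x ≡ 1F
·-inverseʳ {x} x≢0 with inverseTable-correct x
... | inj₁ x≡0 = contradiction x≡0 x≢0
... | inj₂ eq  = eq

·-cancelʳ : ∀ {x} → x ≢ 0V → ∀ y → (y · inv x) · x ≡ y
·-cancelʳ {x} x≢0 y = begin
  (y · inv x) · x  ≡⟨ ·-assoc y (inv x) x ⟩
  y · (inv x · x)  ≡⟨ cong (y ·_) (trans (·-comm (inv x) x) (·-inverseʳ x≢0)) ⟩
  y · 1F           ≡⟨ ·-identityʳ y ⟩
  y                ∎

inv-uniqueʳ : ∀ {x y z} → x ≢ 0V → y · x ≡ z → y ≡ z · inv x
inv-uniqueʳ {x} {y} x≢0 refl = begin
  y                 ≡⟨ ·-identityʳ y ⟨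
  y · 1F            ≡⟨ cong (y ·_) (·-inverseʳ x≢0) ⟨
  y · (x · inv x)   ≡⟨ ·-assoc y x (inv x) ⟨
  (y · x) · inv x   ∎

·-≡0 : ∀ {x y} → x ≢ 0V → y · x ≡ 0V → y ≡ 0V
·-≡0 {x} x≢0 eq = trans (inv-uniqueʳ x≢0 eq) (·-zeroˡ (inv x))

·-≢0 : ∀ {x y} → x ≢ 0V → y ≢ 0V → x · y ≢ 0V
·-≢0 x≢0 y≢0 eq = x≢0 (·-≡0 y≢0 eq)

1≢0 : 1F ≢ 0V
1≢0 ()

inv-≢0 : ∀ {x} → x ≢ 0V → inv x ≢ 0V
inv-≢0 {x} x≢0 eq = 1≢0 (trans (sym (·-inverseʳ x≢0)) (trans (cong (x ·_) eq) (·-zeroʳ x)))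

-- The subfield 𝔽₆₄ and the Desarguesian spread

^-+ : ∀ x m n → x ^ (m + n) ≡ (x ^ m) · (x ^ n)
^-+ x zero    n = sym (·-identityˡ (x ^ n))
^-+ x (suc m) n = trans (cong (x ·_) (^-+ x m n)) (sym (·-assoc x (x ^ m) (x ^ n)))

^-· : ∀ x y n → (x · y) ^ n ≡ (x ^ n) · (y ^ n)
^-· x y zero    = sym (·-identityˡ 1F)
^-· x y (suc n) = trans (cong ((x · y) ·_) (^-· x y n)) (·.interchange x y (x ^ n) (y ^ n))

1^ : ∀ n → 1F ^ n ≡ 1F
1^ zero    = refl
1^ (suc n) = trans (·-identityˡ (1F ^ n)) (1^ n)

square-+ : Additive (λ x → x · x)
square-+ x y = begin
  (x +V y) · (x +V y)                ≡⟨ ·-distribʳ x y (x +V y) ⟩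
  x · (x +V y) +V y · (x +V y)       ≡⟨ cong₂ _+V_ (·-distribˡ x x y) (·-distribˡ y x y) ⟩
  (x · x +V x · y) +V (y · x +V y · y)
    ≡⟨ cong (λ z → (x · x +V x · y) +V (z +V y · y)) (·-comm y x) ⟩
  (x · x +V x · y) +V (x · y +V y · y) ≡⟨ +V-assoc (x · x) (x · y) _ ⟩
  x · x +V (x · y +V (x · y +V y · y)) ≡⟨ cong (x · x +V_) (+V-cancel (x · y) (y · y)) ⟩
  x · x +V y · y                     ∎

^-double-+ : ∀ n → Additive (_^ n) → Additive (_^ (n + n))
^-double-+ n ^-+-homo x y = begin
  (x +V y) ^ (n + n)                          ≡⟨ ^-+ (x +V y) n n ⟩
  ((x +V y) ^ n) · ((x +V y) ^ n)             ≡⟨ cong (λ z → z · z) (^-+-homo x y) ⟩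
  ((x ^ n) +V (y ^ n)) · ((x ^ n) +V (y ^ n)) ≡⟨ square-+ (x ^ n) (y ^ n) ⟩
  (x ^ n) · (x ^ n) +V (y ^ n) · (y ^ n)      ≡⟨ cong₂ _+V_ (^-+ x n n) (^-+ y n n) ⟨
  (x ^ (n + n)) +V (y ^ (n + n))              ∎

-- The sixth iterate of the Frobenius map: 64 arises from 1 by six doublings, each a squaring. The
-- base case is `_· 1F`, to which `_^ 1` unfolds.
^64-+ : Additive (_^ 64)
^64-+ = ^-double-+ 32 (^-double-+ 16 (^-double-+ 8 (^-double-+ 4 (^-double-+ 2 (^-double-+ 1
  (·-XLinear 1F .XLinear.additive))))))

-- A basis of 𝔽₆₄ over 𝔽₂, dual to the coordinates 0, 1, 2, 3, 5, 6.
basis₆₄ : Vec F 6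
basis₆₄ = map (bits 12) (1 ∷ 130 ∷ 1924 ∷ 1544 ∷ 1440 ∷ 1856 ∷ [])

coords₆₄ : F → V 6
coords₆₄ (x₀ ∷ x₁ ∷ x₂ ∷ x₃ ∷ _ ∷ x₅ ∷ x₆ ∷ _) = x₀ ∷ x₁ ∷ x₂ ∷ x₃ ∷ x₅ ∷ x₆ ∷ []

coords₆₄-+ : Additive coords₆₄
coords₆₄-+ (_ ∷ _ ∷ _ ∷ _ ∷ _ ∷ _ ∷ _ ∷ _) (_ ∷ _ ∷ _ ∷ _ ∷ _ ∷ _ ∷ _ ∷ _) = refl

-- A linear projection of `F` onto 𝔽₆₄. Comparing x with its image tests membership in 𝔽₆₄ without a
-- 64th power, which keeps the exhaustive check over `F` cheap.
project₆₄ : F → F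
project₆₄ x = lincomb (coords₆₄ x) basis₆₄

project₆₄-+ : Additive project₆₄
project₆₄-+ x y = trans (cong (λ c → lincomb c basis₆₄) (coords₆₄-+ x y))
                    (lincomb-+ basis₆₄ (coords₆₄ x) (coords₆₄ y))

-- Duality of basis and coordinates, checked on unit vectors. It makes `project₆₄` idempotent and
-- the basis independent.
coords₆₄-lincomb : ∀ c → coords₆₄ (lincomb c basis₆₄) ≡ c
coords₆₄-lincomb = additive-ext
  (λ c d → trans (cong coords₆₄ (lincomb-+ basis₆₄ c d)) (coords₆₄-+ _ _)) (λ _ _ → refl)
  (from-yes (Fin.all? λ i → coords₆₄ (lincomb (unit i) basis₆₄) ≟V unit i))

lincomb-InSubfield64 : ∀ c → InSubfield64 (lincomb c basis₆₄)
lincomb-InSubfield64 c = trans (additive-lincomb {f = _^ 64} ^64-+ c basis₆₄) (cong (lincomb c) fixed)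
  where
  fixed : map (_^ 64) basis₆₄ ≡ basis₆₄
  fixed = from-yes (Vec.≡-dec _≟V_ (map (_^ 64) basis₆₄) basis₆₄)

opaque
  θ : F
  θ = bits 12 54

-- Since θ⁶⁴ + θ = 1, this map takes values in 𝔽₆₄; it visibly fixes 𝔽₆₄.
retract : F → F
retract x = x +V ((x ^ 64) +V x) · θ

retract-+ : Additive retract
retract-+ = +-additive {f = λ x → x} {λ x → ((x ^ 64) +V x) · θ} (λ _ _ → refl)
  (∘-additive {f = _· θ} {λ x → (x ^ 64) +V x} (λ x y → ·-distribʳ x y θ)
    (+-additive {f = _^ 64} {λ x → x} ^64-+ (λ _ _ → refl)))

opaque
  unfolding θ

  project-retract-unit : ∀ i → project₆₄ (retract (unit i)) ≡ retract (unit i)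
  project-retract-unit = from-yes (Fin.all? λ i → project₆₄ (retract (unit i)) ≟V retract (unit i))

project-retract : ∀ x → project₆₄ (retract x) ≡ retract x
project-retract = additive-ext {f = λ x → project₆₄ (retract x)} {retract}
  (∘-additive {f = project₆₄} {retract} project₆₄-+ retract-+) retract-+ project-retract-unit

retract-fixes : ∀ {x} → InSubfield64 x → retract x ≡ x
retract-fixes {x} x∈ = begin
  x +V ((x ^ 64) +V x) · θ  ≡⟨ cong (λ z → x +V (z +V x) · θ) x∈ ⟩
  x +V (x +V x) · θ         ≡⟨ cong (λ z → x +V z · θ) (+V-self x) ⟩
  x +V 0V · θ               ≡⟨ cong (x +V_) (·-zeroˡ θ) ⟩
  x +V 0V                   ≡⟨ +V-identityʳ x ⟩
  x                         ∎

-- No counting of the roots of x⁶⁴ = x is involved: such an x is its own image under `retract`, and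
-- the image of `retract` lies in the span of `basis₆₄`, which by linearity only has to be checked
-- on unit vectors.
InSubfield64⇒project : ∀ {x} → InSubfield64 x → x ≡ project₆₄ x
InSubfield64⇒project {x} x∈ = begin
  x                     ≡⟨ retract-fixes x∈ ⟨
  retract x             ≡⟨ project-retract x ⟨
  project₆₄ (retract x) ≡⟨ cong project₆₄ (retract-fixes x∈) ⟩
  project₆₄ x           ∎

project⇒InSubfield64 : ∀ {x} → x ≡ project₆₄ x → InSubfield64 x
project⇒InSubfield64 {x} eq = subst InSubfield64 (sym eq) (lincomb-InSubfield64 (coords₆₄ x))

InSubfield64-1 : InSubfield64 1F
InSubfield64-1 = 1^ 64

InSubfield64-+ : ∀ {x y} → InSubfield64 x → InSubfield64 y → InSubfield64 (x +V y)
InSubfield64-+ {x} {y} x∈ y∈ = trans (^64-+ x y) (cong₂ _+V_ x∈ y∈)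

InSubfield64-• : ∀ μ {x} → InSubfield64 x → InSubfield64 (μ • x)
InSubfield64-• μ {x} x∈ = trans (additive-• {f = _^ 64} ^64-+ μ x) (cong (μ •_) x∈)

-- The exponent is a variable, here and in `fixed-inv`, so that the power does not unfold into a
-- product of 64 factors.
fixed-· : ∀ n {x y} → x ^ n ≡ x → y ^ n ≡ y → (x · y) ^ n ≡ x · y
fixed-· n {x} {y} x∈ y∈ = trans (^-· x y n) (cong₂ _·_ x∈ y∈)

fixed-inv : ∀ n {x} → x ≢ 0V → x ^ n ≡ x → inv x ^ n ≡ inv x
fixed-inv n {x} x≢0 x∈ = begin
  inv x ^ n         ≡⟨ inv-uniqueʳ x≢0 inverse ⟩
  1F · inv x        ≡⟨ ·-identityˡ (inv x) ⟩
  inv x             ∎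
  where
  inverse : (inv x ^ n) · x ≡ 1F
  inverse = begin
    (inv x ^ n) · x          ≡⟨ cong ((inv x ^ n) ·_) x∈ ⟨
    (inv x ^ n) · (x ^ n)    ≡⟨ ^-· (inv x) x n ⟨
    (inv x · x) ^ n          ≡⟨ cong (_^ n) (trans (·-comm (inv x) x) (·-inverseʳ x≢0)) ⟩
    1F ^ n                   ≡⟨ 1^ n ⟩
    1F                       ∎

InSubfield64-· : ∀ {x y} → InSubfield64 x → InSubfield64 y → InSubfield64 (x · y)
InSubfield64-· = fixed-· 64

InSubfield64-inv : ∀ {x} → x ≢ 0V → InSubfield64 x → InSubfield64 (inv x)
InSubfield64-inv = fixed-inv 64

DesGroup-self : ∀ i → DesGroup i (proj₁ i)
DesGroup-self (y , _) = 1F , InSubfield64-1 , sym (·-identityˡ y)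

-- From x = l y = m z ≠ 0 one gets k y = (k / l) x = (k / l) m z, with multiplier still in 𝔽₆₄.
-- Exchanging the two groups gives the other inclusion.
DesGroup-transport : ∀ {i x} → x ≢ 0V → DesGroup i x → ∀ j → DesGroup j x → DesGroup i ⊆ DesGroup j
DesGroup-transport {y , _} {x} x≢0 (l , l∈ , x≡ly) (z , _) (m , m∈ , x≡mz) w (k , k∈ , w≡ky) =
  (k · inv l) · m , InSubfield64-· (InSubfield64-· k∈ (InSubfield64-inv l≢0 l∈)) m∈ , (begin
    w                      ≡⟨ w≡ky ⟩
    k · y                  ≡⟨ cong (_· y) (·-cancelʳ l≢0 k) ⟨
    ((k · inv l) · l) · y  ≡⟨ ·-assoc (k · inv l) l y ⟩
    (k · inv l) · (l · y)  ≡⟨ cong ((k · inv l) ·_) (trans (sym x≡ly) x≡mz) ⟩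
    (k · inv l) · (m · z)  ≡⟨ ·-assoc (k · inv l) m z ⟨
    ((k · inv l) · m) · z  ∎)
  where
  l≢0 : l ≢ 0V
  l≢0 refl = x≢0 (trans x≡ly (·-zeroˡ y))

-- Multiplication by y ≠ 0 is linear and injective, so it carries the basis of 𝔽₆₄ to a basis of the
-- group of y.
DesGroup-dim : ∀ i → HasDim 6 (DesGroup i)
DesGroup-dim (y , y≢0) = map (_· y) basis₆₄ , independent , spanned , contained
  where
  lincomb-·y : ∀ c → lincomb c basis₆₄ · y ≡ lincomb c (map (_· y) basis₆₄)
  lincomb-·y c = additive-lincomb (XLinear.additive (·-XLinear y)) c basis₆₄
  independent : Independent (map (_· y) basis₆₄)
  independent c eq = begin
    c                                ≡⟨ coords₆₄-lincomb c ⟨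
    coords₆₄ (lincomb c basis₆₄)     ≡⟨ cong coords₆₄ (·-≡0 y≢0 (trans (lincomb-·y c) eq)) ⟩
    replicate 6 false                ∎
  spanned : DesGroup (y , y≢0) ⊆ InSpan (map (_· y) basis₆₄)
  spanned x (l , l∈ , x≡ly) = coords₆₄ l , (begin
    x                                    ≡⟨ x≡ly ⟩
    l · y                                ≡⟨ cong (_· y) (InSubfield64⇒project l∈) ⟩
    project₆₄ l · y                      ≡⟨ lincomb-·y (coords₆₄ l) ⟩
    lincomb (coords₆₄ l) (map (_· y) basis₆₄) ∎)
  contained : InSpan (map (_· y) basis₆₄) ⊆ DesGroup (y , y≢0)
  contained x (c , eq) = lincomb c basis₆₄ , lincomb-InSubfield64 c , trans eq (sym (lincomb-·y c))

-- Flags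

lincomb₂ : ∀ {n} c d (x y : V n) → lincomb (c ∷ d ∷ []) (x ∷ y ∷ []) ≡ (c • x) +V (d • y)
lincomb₂ c d x y = cong ((c • x) +V_) (+V-identityʳ (d • y))

-- The elements of a line in a form free of scalars and zero summands, so that they match the
-- members of `lineFlags` by `refl`.
point : ∀ {n} → Bool → Bool → V n → V n → V n
point false false x y = 0V
point true  false x y = x
point false true  x y = y
point true  true  x y = x +V y

lincomb-point : ∀ {n} c d (x y : V n) → lincomb (c ∷ d ∷ []) (x ∷ y ∷ []) ≡ point c d x y
lincomb-point c d x y = trans (lincomb₂ c d x y) (go c d)
  where
  go : ∀ c d → (c • x) +V (d • y) ≡ point c d x y
  go false false = trans (cong₂ _+V_ (false• x) (false• y)) (+V-self 0V)
  go true  false = trans (cong₂ _+V_ (true• x) (false• y)) (+V-identityʳ x)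
  go false true  = trans (cong₂ _+V_ (false• x) (true• y)) (+V-identityˡ y)
  go true  true  = cong₂ _+V_ (true• x) (true• y)

point∈⟨_,_⟩ : ∀ {n} (x y : V n) c d → ⟨ x , y ⟩ (point c d x y)
point∈⟨ x , y ⟩ c d = c ∷ d ∷ [] , sym (lincomb-point c d x y)

⟨⟩-least : ∀ {n} {x y x′ y′ : V n} → ⟨ x , y ⟩ x′ → ⟨ x , y ⟩ y′ → ⟨ x′ , y′ ⟩ ⊆ ⟨ x , y ⟩
⟨⟩-least {x = x} {y} (c , refl) (d , refl) z (μ ∷ ν ∷ [] , refl) = (μ • c) +V (ν • d) , sym (begin
  lincomb ((μ • c) +V (ν • d)) e                     ≡⟨ lincomb-+ e (μ • c) (ν • d) ⟩
  lincomb (μ • c) e +V lincomb (ν • d) e             ≡⟨ cong₂ _+V_ (additive-• (lincomb-+ e) μ c) (additive-• (lincomb-+ e) ν d) ⟩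
  (μ • lincomb c e) +V (ν • lincomb d e)             ≡⟨ lincomb₂ μ ν (lincomb c e) (lincomb d e) ⟨
  lincomb (μ ∷ ν ∷ []) (lincomb c e ∷ lincomb d e ∷ []) ∎)
  where e = x ∷ y ∷ []

module _ {n} {x y : V n} (ind : Independent (x ∷ y ∷ [])) where

  independent⇒≢0ˡ : x ≢ 0V
  independent⇒≢0ˡ x≡0 with () ← ind (true ∷ false ∷ []) (trans (lincomb-point true false x y) x≡0)

  independent⇒≢0ʳ : y ≢ 0V
  independent⇒≢0ʳ y≡0 with () ← ind (false ∷ true ∷ []) (trans (lincomb-point false true x y) y≡0)

  independent⇒≢ : x ≢ y
  independent⇒≢ refl with () ← ind (true ∷ true ∷ []) (trans (lincomb-point true true x y) (+V-self x))

-- A flag of a line or triangle is an ordered basis of the line or of a side.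
Flag : Set
Flag = F × F

lineFlags : F → F → List Flag
lineFlags x y = (x , y) ∷ (y , x) ∷ (x , x +V y) ∷ (x +V y , x) ∷ (y , x +V y) ∷ (x +V y , y) ∷ []

flags : Tri 12 → List Flag
flags T = lineFlags (a T) (b T) ++ lineFlags (b T) (c T) ++ lineFlags (c T) (a T)

-- Among x, y and x + y the sum of any two is the third, so any two of them span the line.
lineFlag⇒≐ : ∀ {x y x′ y′} → (x′ , y′) ∈ lineFlags x y → ⟨ x , y ⟩ ≐ ⟨ x′ , y′ ⟩
lineFlag⇒≐ {x} {y} = λ
  { (here refl) → ≐ (in₁ x y) (in₂ x y) (in₁ x y) (in₂ x y)
  ; (there (here refl)) → ≐ (in₂ y x) (in₁ y x) (in₂ x y) (in₁ x y)
  ; (there (there (here refl))) → ≐ (in₁ x z) (in₃ x+z≡y) (in₁ x y) (in₃ refl)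
  ; (there (there (there (here refl)))) →
      ≐ (in₂ z x) (in₃ (trans (+V-comm z x) x+z≡y)) (in₃ refl) (in₁ x y)
  ; (there (there (there (there (here refl))))) → ≐ (in₃ y+z≡x) (in₁ y z) (in₂ x y) (in₃ refl)
  ; (there (there (there (there (there (here refl)))))) →
      ≐ (in₃ (trans (+V-comm z y) y+z≡x)) (in₂ z y) (in₃ refl) (in₂ x y) }
  where
  z = x +V y
  x+z≡y : x +V z ≡ y
  x+z≡y = +V-cancel x y
  y+z≡x : y +V z ≡ x
  y+z≡x = trans (cong (y +V_) (+V-comm x y)) (+V-cancel y x)
  in₁ : ∀ u v → ⟨ u , v ⟩ u
  in₁ u v = point∈⟨ u , v ⟩ true false
  in₂ : ∀ u v → ⟨ u , v ⟩ v
  in₂ u v = point∈⟨ u , v ⟩ false true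
  in₃ : ∀ {u v w} → u +V v ≡ w → ⟨ u , v ⟩ w
  in₃ {u} {v} refl = point∈⟨ u , v ⟩ true true
  ≐ : ∀ {u v} → ⟨ u , v ⟩ x → ⟨ u , v ⟩ y → ⟨ x , y ⟩ u → ⟨ x , y ⟩ v → ⟨ x , y ⟩ ≐ ⟨ u , v ⟩
  ≐ p q r s = ⟨⟩-least p q , ⟨⟩-least r s

-- Both x′ and y′ are among the four vectors of ⟨x, y⟩. Independence excludes zero vectors and x′ =
-- y′, which leaves six of the sixteen cases.
≐⇒lineFlag : ∀ {x y x′ y′} → Independent (x′ ∷ y′ ∷ []) → ⟨ x , y ⟩ ≐ ⟨ x′ , y′ ⟩ → (x′ , y′) ∈ lineFlags x y
≐⇒lineFlag {x} {y} {x′} {y′} ind (_ , ⊇)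
  with c ∷ d ∷ [] , eq ← ⊇ x′ (point∈⟨ x′ , y′ ⟩ true false)
  with c′ ∷ d′ ∷ [] , eq′ ← ⊇ y′ (point∈⟨ x′ , y′ ⟩ false true)
  = go c d c′ d′ (trans eq (lincomb-point c d x y)) (trans eq′ (lincomb-point c′ d′ x y))
  where
  go : ∀ c d c′ d′ → x′ ≡ point c d x y → y′ ≡ point c′ d′ x y → (x′ , y′) ∈ lineFlags x y
  go false false c′    d′    p q = contradiction p (independent⇒≢0ˡ ind)
  go true  d     false false p q = contradiction q (independent⇒≢0ʳ ind)
  go false true  false false p q = contradiction q (independent⇒≢0ʳ ind)
  go true  false true  false p q = contradiction (trans p (sym q)) (independent⇒≢ ind)
  go false true  false true  p q = contradiction (trans p (sym q)) (independent⇒≢ ind)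
  go true  true  true  true  p q = contradiction (trans p (sym q)) (independent⇒≢ ind)
  go true  false false true  refl refl = here refl
  go false true  true  false refl refl = there (here refl)
  go true  false true  true  refl refl = there (there (here refl))
  go true  true  true  false refl refl = there (there (there (here refl)))
  go false true  true  true  refl refl = there (there (there (there (here refl))))
  go true  true  false true  refl refl = there (there (there (there (there (here refl)))))

flag⇒side : ∀ T {x y} → (x , y) ∈ flags T → HasSide T ⟨ x , y ⟩
flag⇒side T xy∈ with ∈-++⁻ (lineFlags (a T) (b T)) xy∈
... | inj₁ xy∈ab = inj₁ (lineFlag⇒≐ xy∈ab)
... | inj₂ xy∈′ with ∈-++⁻ (lineFlags (b T) (c T)) xy∈′
...   | inj₁ xy∈bc = inj₂ (inj₁ (lineFlag⇒≐ xy∈bc))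
...   | inj₂ xy∈ca = inj₂ (inj₂ (lineFlag⇒≐ xy∈ca))

side⇒flag : ∀ T {x y} → Independent (x ∷ y ∷ []) → HasSide T ⟨ x , y ⟩ → (x , y) ∈ flags T
side⇒flag T ind (inj₁ eq)        = ∈-++⁺ˡ (≐⇒lineFlag ind eq)
side⇒flag T ind (inj₂ (inj₁ eq)) = ∈-++⁺ʳ (lineFlags (a T) (b T)) (∈-++⁺ˡ (≐⇒lineFlag ind eq))
side⇒flag T ind (inj₂ (inj₂ eq)) =
  ∈-++⁺ʳ (lineFlags (a T) (b T)) (∈-++⁺ʳ (lineFlags (b T) (c T)) (≐⇒lineFlag ind eq))

scaleFlag : F → Flag → Flag
scaleFlag g (x , y) = g · x , g · y

flags-scale : ∀ g T → flags (scaleTri g T) ≡ List.map (scaleFlag g) (flags T)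
flags-scale g T
  rewrite ·-distribˡ g (a T) (b T) | ·-distribˡ g (b T) (c T) | ·-distribˡ g (c T) (a T) = refl

flags-scale⁻ : ∀ g T {x y} → (x , y) ∈ flags (scaleTri g T) →
               ∃ λ p → ∃ λ q → (p , q) ∈ flags T × x ≡ g · p × y ≡ g · q
flags-scale⁻ g T {x} {y} xy∈
  with (p , q) , pq∈ , eq ← ∈-map⁻ (scaleFlag g) (subst ((x , y) ∈_) (flags-scale g T) xy∈)
  = p , q , pq∈ , cong proj₁ eq , cong proj₂ eq

flags-scale⁺ : ∀ g T {p q} → (p , q) ∈ flags T → (g · p , g · q) ∈ flags (scaleTri g T)
flags-scale⁺ g T {p} {q} pq∈ =
  subst ((g · p , g · q) ∈_) (sym (flags-scale g T)) (∈-map⁺ (scaleFlag g) pq∈)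

-- The base triangles

_≟T_ : DecidableEquality (Tri 12)
tri x y z ≟T tri x′ y′ z′ = map′ (λ { (refl , refl , refl) → refl }) (λ { refl → refl , refl , refl })
  ((x ≟V x′) ×-dec (y ≟V y′) ×-dec (z ≟V z′))

triIndependent? : ∀ (T : Tri 12) → Dec (TriIndependent T)
triIndependent? T = ∀Vec? 3 λ γ → (lincomb γ (a T ∷ b T ∷ c T ∷ []) ≟V 0V) →-dec (γ ≟V replicate 3 false)

-- The entry (r , T , p) records that (p , r p) is a flag of T.
Entry : Set
Entry = F × Tri 12 × F

-- The inversion i is a parameter so that the finite check can receive the inverse table as an
-- argument.
entry : (F → F) → Tri 12 → Flag → Entry
entry i T (p , q) = q · i p , T , p

entriesOf : (F → F) → Tri 12 → List Entry
entriesOf i T = List.map (entry i T) (flags T)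

entries : (F → F) → List (Tri 12) → List Entry
entries i = concatMap (entriesOf i)

∈-entries⁺ : ∀ i {Ts T p q} → T ∈ Ts → (p , q) ∈ flags T → (q · i p , T , p) ∈ entries i Ts
∈-entries⁺ i T∈ pq∈ = ∈-concatMap⁺ (entriesOf i) (Any.map (λ { refl → ∈-map⁺ (entry i _) pq∈ }) T∈)

∈-entries⁻ : ∀ i {Ts r T p} → (r , T , p) ∈ entries i Ts → T ∈ Ts × ∃ λ q → (p , q) ∈ flags T × r ≡ q · i p
∈-entries⁻ i {Ts} r∈ with T′ , T∈ , r∈T ← ∈-find (∈-concatMap⁻ (entriesOf i) {xs = Ts} r∈)
  with (p , q) , pq∈ , refl ← ∈-map⁻ (entry i T′) r∈T = T∈ , q , pq∈ , refl

-- Demanding that each entry be found under its own key forbids two different entries with the same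
-- ratio, so uniqueness is checked by one lookup per entry instead of pairwise comparison.
Separated : Trie (Tri 12 × F) 12 → Entry → Set
Separated t (r , e) = proj₂ e ≢ 0V × r ≢ project₆₄ r × find t r ≡ just e

-- For a table built by `fromList`, each hit comes from an entry (`find-fromList`), so every ratio
-- outside 𝔽₆₄ is realized by a flag.
Exhaustive : Trie (Tri 12 × F) 12 → Set
Exhaustive t = ∀ r → r ≡ project₆₄ r ⊎ ∃ λ e → find t r ≡ just e

Perfect : List Entry → Trie (Tri 12 × F) 12 → Set
Perfect es t = All (Separated t) es × Exhaustive t

perfect? : ∀ es t → Dec (Perfect es t)
perfect? es t =
  All.all? (λ (r , e) → ¬? (proj₂ e ≟V 0V) ×-dec ¬? (r ≟V project₆₄ r) ×-dec (find t r ≟E just e)) es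
  ×-dec ∀Vec? 12 (λ r → (r ≟V project₆₄ r) ⊎-dec found? (find t r))
  where
  _≟E_ : DecidableEquality (Maybe (Tri 12 × F))
  _≟E_ = Maybe.≡-dec (Product.≡-dec _≟T_ _≟V_)
  found? : (m : Maybe (Tri 12 × F)) → Dec (∃ λ e → m ≡ just e)
  found? (just e) = yes (e , refl)
  found? nothing  = no λ ()

-- The entries and the table built from them are passed as arguments so that the
-- evaluator computes each of them only once.
perfectOver? : ∀ t Ts → Dec (Perfect (entries (inverseIn t) Ts) (fromList (entries (inverseIn t) Ts)))
perfectOver? t Ts = onEntries (entries (inverseIn t) Ts)
  where
  onEntries : ∀ es → Dec (Perfect es (fromList es))
  onEntries es = perfect? es (fromList es)

triangle : ℕ × ℕ → Tri 12
triangle (y , z) = tri 1F (bits 12 y) (bits 12 z)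

-- Representatives (1, y, z) of the 224 orbits of blocks, found by computer search;
-- bit i of a number is the coefficient of Xⁱ.
opaque
  base : List (Tri 12)
  base = List.map triangle (
    (5 , 1997) ∷ (8 , 765) ∷ (10 , 2753) ∷ (13 , 3172) ∷ (19 , 2588) ∷ (20 , 2085) ∷
    (22 , 2895) ∷ (25 , 547) ∷ (26 , 3228) ∷ (30 , 1269) ∷ (32 , 2404) ∷ (34 , 3871) ∷
    (37 , 173) ∷ (39 , 2306) ∷ (40 , 149) ∷ (47 , 1442) ∷ (49 , 3164) ∷ (50 , 3957) ∷
    (57 , 2285) ∷ (59 , 619) ∷ (61 , 745) ∷ (64 , 2214) ∷ (69 , 2494) ∷ (72 , 2247) ∷
    (81 , 484) ∷ (82 , 1065) ∷ (85 , 1302) ∷ (86 , 949) ∷ (88 , 3738) ∷ (90 , 3694) ∷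
    (92 , 1243) ∷ (94 , 175) ∷ (97 , 3950) ∷ (99 , 3705) ∷ (104 , 731) ∷ (107 , 3647) ∷
    (111 , 2871) ∷ (113 , 3918) ∷ (114 , 2613) ∷ (116 , 2043) ∷ (123 , 3288) ∷ (126 , 596) ∷
    (128 , 1963) ∷ (132 , 658) ∷ (134 , 1693) ∷ (136 , 425) ∷ (139 , 2937) ∷ (145 , 537) ∷
    (147 , 3162) ∷ (155 , 2546) ∷ (158 , 1445) ∷ (164 , 1144) ∷ (166 , 3807) ∷ (169 , 299) ∷
    (171 , 1519) ∷ (186 , 1771) ∷ (188 , 935) ∷ (191 , 3692) ∷ (193 , 3817) ∷ (198 , 3010) ∷
    (200 , 3690) ∷ (208 , 1648) ∷ (212 , 3613) ∷ (215 , 302) ∷ (217 , 1178) ∷ (219 , 390) ∷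
    (223 , 236) ∷ (225 , 4010) ∷ (228 , 1392) ∷ (232 , 2835) ∷ (235 , 1968) ∷ (241 , 1589) ∷
    (242 , 3785) ∷ (244 , 690) ∷ (246 , 1151) ∷ (248 , 3557) ∷ (251 , 3922) ∷ (253 , 2136) ∷
    (255 , 663) ∷ (257 , 804) ∷ (259 , 2849) ∷ (261 , 3925) ∷ (263 , 1384) ∷ (273 , 411) ∷
    (276 , 1070) ∷ (279 , 3069) ∷ (283 , 2077) ∷ (287 , 3028) ∷ (291 , 1115) ∷ (314 , 2098) ∷
    (316 , 3077) ∷ (318 , 1155) ∷ (326 , 2681) ∷ (335 , 1750) ∷ (336 , 4050) ∷ (342 , 835) ∷
    (345 , 1592) ∷ (347 , 3575) ∷ (357 , 1527) ∷ (360 , 3683) ∷ (363 , 3554) ∷ (365 , 2674) ∷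
    (367 , 2140) ∷ (368 , 2647) ∷ (370 , 2390) ∷ (376 , 2930) ∷ (382 , 2736) ∷ (388 , 2873) ∷
    (395 , 3403) ∷ (405 , 1372) ∷ (407 , 3218) ∷ (421 , 3891) ∷ (428 , 1985) ∷ (442 , 1669) ∷
    (444 , 4039) ∷ (447 , 3333) ∷ (457 , 1248) ∷ (466 , 2373) ∷ (470 , 2552) ∷ (476 , 2988) ∷
    (481 , 2635) ∷ (488 , 3368) ∷ (500 , 2349) ∷ (504 , 1162) ∷ (506 , 4084) ∷ (514 , 2016) ∷
    (520 , 3833) ∷ (523 , 2457) ∷ (525 , 3066) ∷ (534 , 3589) ∷ (538 , 1520) ∷ (550 , 1284) ∷
    (554 , 757) ∷ (557 , 2702) ∷ (560 , 1531) ∷ (569 , 2538) ∷ (572 , 2980) ∷ (580 , 2967) ∷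
    (582 , 1036) ∷ (588 , 3678) ∷ (591 , 1277) ∷ (598 , 2528) ∷ (602 , 3461) ∷ (612 , 1775) ∷
    (623 , 3508) ∷ (624 , 1056) ∷ (627 , 2130) ∷ (640 , 1019) ∷ (643 , 3075) ∷ (645 , 714) ∷
    (647 , 3057) ∷ (648 , 1391) ∷ (652 , 1960) ∷ (666 , 3415) ∷ (680 , 1157) ∷ (684 , 1371) ∷
    (686 , 2356) ∷ (689 , 708) ∷ (692 , 1546) ∷ (697 , 2369) ∷ (702 , 2825) ∷ (717 , 972) ∷
    (721 , 2166) ∷ (726 , 2757) ∷ (752 , 3501) ∷ (754 , 2363) ∷ (759 , 1477) ∷ (772 , 3411) ∷
    (775 , 1062) ∷ (778 , 2192) ∷ (781 , 3670) ∷ (790 , 1214) ∷ (794 , 3921) ∷ (809 , 3041) ∷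
    (814 , 3975) ∷ (837 , 1491) ∷ (841 , 3936) ∷ (866 , 2890) ∷ (869 , 2462) ∷ (874 , 2668) ∷
    (966 , 1761) ∷ (968 , 2230) ∷ (976 , 2172) ∷ (978 , 3412) ∷ (981 , 3878) ∷ (982 , 2442) ∷
    (988 , 1686) ∷ (993 , 2828) ∷ (1005 , 2723) ∷ (1066 , 4093) ∷ (1075 , 1720) ∷
    (1076 , 1319) ∷ (1083 , 3687) ∷ (1107 , 3078) ∷ (1137 , 3006) ∷ (1147 , 2241) ∷
    (1164 , 4034) ∷ (1169 , 3905) ∷ (1171 , 2946) ∷ (1183 , 1995) ∷ (1231 , 3711) ∷
    (1260 , 2778) ∷ (1264 , 4049) ∷ (1296 , 2198) ∷ (1316 , 3527) ∷ (1331 , 3605) ∷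
    (1336 , 3418) ∷ (1351 , 1876) ∷ (1359 , 3835) ∷ (1396 , 1638) ∷ (1411 , 2355) ∷
    (1419 , 3581) ∷ (1430 , 4014) ∷ (1469 , 2323) ∷ (1500 , 4064) ∷ (1503 , 3049) ∷
    (1514 , 1609) ∷ (1596 , 3428) ∷ (1624 , 2605) ∷ (1650 , 1746) ∷ (1893 , 2814) ∷
    (1912 , 2776) ∷ (2164 , 3134) ∷ (2435 , 3883) ∷ []
    )

  base-independent : All TriIndependent base
  base-independent = from-yes (All.all? triIndependent? base)

  base-unique : Unique base
  -- The second vertices alone are already distinct.
  base-unique = Unique.map⁻ {f = b} (from-yes (unique? _≟V_ (List.map b base)))

opaque
  unfolding inverseTable base

  base-perfect : Perfect (entries (inverseIn inverseTable) base)
                         (fromList (entries (inverseIn inverseTable) base))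
  base-perfect = from-yes (perfectOver? inverseTable base)

-- Ratios of flags of scaled base triangles

ratio-· : ∀ {x y r} → x ≢ 0V → r · x ≡ y → y · inv x ≡ r
ratio-· x≢0 eq = sym (inv-uniqueʳ x≢0 eq)

opaque
  table : Trie (Tri 12 × F) 12
  table = fromList (entries inv base)

  table-separated : All (Separated table) (entries inv base)
  table-separated = proj₁ base-perfect

  table-exhaustive : Exhaustive table
  table-exhaustive = proj₂ base-perfect

  find-table : ∀ {r e} → find table r ≡ just e → (r , e) ∈ entries inv base
  find-table = find-fromList (entries inv base)

flag-separated : ∀ {T p q} → T ∈ base → (p , q) ∈ flags T → Separated table (q · inv p , T , p)
flag-separated T∈ pq∈ = All.lookup table-separated (∈-entries⁺ inv T∈ pq∈)

-- Scaling by g cancels in the ratio, (g q) / (g p) = q / p, so the lookup of y / x recovers the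
-- base triangle T and the vector p of its flag.
scaledFlag-find : ∀ {g T x y} → T ∈ base → x ≢ 0V → (x , y) ∈ flags (scaleTri g T) →
                  ∃ λ p → p ≢ 0V × x ≡ g · p × ¬ InSubfield64 (y · inv x) × find table (y · inv x) ≡ just (T , p)
scaledFlag-find {g} {T} {x} {y} T∈ x≢0 xy∈ =
  let p , q , pq∈ , x≡gp , y≡gq = flags-scale⁻ g T xy∈
      p≢0 , r∉ , found = flag-separated T∈ pq∈
      ratio : y · inv x ≡ q · inv p
      ratio = ratio-· x≢0 (begin
        (q · inv p) · x        ≡⟨ cong ((q · inv p) ·_) x≡gp ⟩
        (q · inv p) · (g · p)  ≡⟨ ·.x∙yz≈y∙xz (q · inv p) g p ⟩
        g · ((q · inv p) · p)  ≡⟨ cong (g ·_) (·-cancelʳ p≢0 q) ⟩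
        g · q                  ≡⟨ y≡gq ⟨
        y                      ∎)
  in p , p≢0 , x≡gp
     , (λ r∈ → r∉ (InSubfield64⇒project (subst InSubfield64 ratio r∈)))
     , trans (cong (find table) ratio) found

-- A hit yields a flag (p, q) of T with q / p = y / x. The factor x / p takes p to x, hence also q
-- to y.
find-scaledFlag : ∀ {T p x y} → x ≢ 0V → find table (y · inv x) ≡ just (T , p) →
                  T ∈ base × p ≢ 0V × (x , y) ∈ flags (scaleTri (x · inv p) T)
find-scaledFlag {T} {p} {x} {y} x≢0 found =
  let T∈ , q , pq∈ , r≡ = ∈-entries⁻ inv {Ts = base} (find-table found)
      p≢0 = proj₁ (flag-separated T∈ pq∈)
      g = x · inv p
      gq≡y : g · q ≡ y
      gq≡y = begin
        (x · inv p) · q    ≡⟨ ·-assoc x (inv p) q ⟩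
        x · (inv p · q)    ≡⟨ cong (x ·_) (·-comm (inv p) q) ⟩
        x · (q · inv p)    ≡⟨ ·-comm x (q · inv p) ⟩
        (q · inv p) · x    ≡⟨ cong (_· x) r≡ ⟨
        (y · inv x) · x    ≡⟨ ·-cancelʳ x≢0 y ⟩
        y                  ∎
  in T∈ , p≢0 , subst (_∈ flags (scaleTri g T)) (cong₂ _,_ (·-cancelʳ p≢0 x) gq≡y) (flags-scale⁺ g T pq∈)

-- The blocks

vectors : ∀ n → List (V n)
vectors zero    = [] ∷ []
vectors (suc n) = List.map (false ∷_) (vectors n) ++ List.map (true ∷_) (vectors n)

∈-vectors : ∀ {n} (v : V n) → v ∈ vectors n
∈-vectors []          = here refl
∈-vectors (false ∷ v) = ∈-++⁺ˡ (∈-map⁺ (false ∷_) (∈-vectors v))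
∈-vectors (true  ∷ v) = ∈-++⁺ʳ _ (∈-map⁺ (true ∷_) (∈-vectors v))

vectors-unique : ∀ n → Unique (vectors n)
vectors-unique zero    = [] ∷ []
vectors-unique (suc n) = Unique.++⁺
  (Unique.map⁺ Vec.∷-injectiveʳ (vectors-unique n)) (Unique.map⁺ Vec.∷-injectiveʳ (vectors-unique n)) disjoint
  where
  disjoint : Disjoint (List.map (false ∷_) (vectors n)) (List.map (true ∷_) (vectors n))
  disjoint (v∈ , v∈′) with _ , _ , refl ← ∈-map⁻ (false ∷_) v∈ with _ , _ , () ← ∈-map⁻ (true ∷_) v∈′

nonzero? : ∀ {n} (v : V n) → Dec (v ≢ 0V)
nonzero? v = ¬? (v ≟V 0V)

nonzeroVectors : ∀ n → List (V n)
nonzeroVectors n = filter nonzero? (vectors n)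

∈-nonzeroVectors⁺ : ∀ {n} {v : V n} → v ≢ 0V → v ∈ nonzeroVectors n
∈-nonzeroVectors⁺ {v = v} = ∈-filter⁺ nonzero? (∈-vectors v)

∈-nonzeroVectors⁻ : ∀ {n} {v : V n} → v ∈ nonzeroVectors n → v ≢ 0V
∈-nonzeroVectors⁻ {n} v∈ = proj₂ (∈-filter⁻ nonzero? {xs = vectors n} v∈)

nonzeroVectors-unique : ∀ n → Unique (nonzeroVectors n)
nonzeroVectors-unique n = Unique.filter⁺ nonzero? (vectors-unique n)

opaque
  nonzeros : List F
  nonzeros = nonzeroVectors 12

  ∈-nonzeros⁺ : ∀ {x} → x ≢ 0V → x ∈ nonzeros
  ∈-nonzeros⁺ = ∈-nonzeroVectors⁺ {12}

  ∈-nonzeros⁻ : ∀ {x} → x ∈ nonzeros → x ≢ 0V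
  ∈-nonzeros⁻ = ∈-nonzeroVectors⁻ {12}

  nonzeros-unique : Unique nonzeros
  nonzeros-unique = nonzeroVectors-unique 12

-- Blocks are indexed by pairs of a scalar and a base triangle. Distinctness of pairs is immediate,
-- and positions in `blocks` are compared through them.
placements : List (F × Tri 12)
placements = cartesianProduct nonzeros base

placements-unique : Unique placements
placements-unique = Unique.cartesianProduct⁺ nonzeros-unique base-unique

∈-placements⁺ : ∀ {g T} → g ≢ 0V → T ∈ base → (g , T) ∈ placements
∈-placements⁺ g≢0 T∈ = ∈-cartesianProduct⁺ (∈-nonzeros⁺ g≢0) T∈

∈-placements⁻ : ∀ {g T} → (g , T) ∈ placements → g ≢ 0V × T ∈ base
∈-placements⁻ gT∈ = let g∈ , T∈ = ∈-cartesianProduct⁻ nonzeros base gT∈ in ∈-nonzeros⁻ g∈ , T∈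

place : F × Tri 12 → Tri 12
place (g , T) = scaleTri g T

blocks : List (Tri 12)
blocks = List.map place placements

∈-blocks⁺ : ∀ {g T} → g ≢ 0V → T ∈ base → scaleTri g T ∈ blocks
∈-blocks⁺ g≢0 T∈ = ∈-map⁺ place (∈-placements⁺ g≢0 T∈)

∈-blocks⁻ : ∀ {T} → T ∈ blocks → ∃ λ g → ∃ λ T₀ → g ≢ 0V × T₀ ∈ base × T ≡ scaleTri g T₀
∈-blocks⁻ T∈ =
  let (g , T₀) , gT∈ , eq = ∈-map⁻ place T∈
      g≢0 , T₀∈ = ∈-placements⁻ gT∈
  in g , T₀ , g≢0 , T₀∈ , eq

scaleTri-· : ∀ g h T → scaleTri g (scaleTri h T) ≡ scaleTri (g · h) T
scaleTri-· g h T rewrite ·-assoc g h (a T) | ·-assoc g h (b T) | ·-assoc g h (c T) = refl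

scaleTri-1 : ∀ T → scaleTri 1F T ≡ T
scaleTri-1 T rewrite ·-identityˡ (a T) | ·-identityˡ (b T) | ·-identityˡ (c T) = refl

blocks-scale : ∀ {g T} → g ≢ 0V → T ∈ blocks → scaleTri g T ∈ blocks
blocks-scale {g} g≢0 T∈ =
  let h , T₀ , h≢0 , T₀∈ , T≡ = ∈-blocks⁻ T∈
  in subst (_∈ blocks) (sym (trans (cong (scaleTri g) T≡) (scaleTri-· g h T₀))) (∈-blocks⁺ (·-≢0 g≢0 h≢0) T₀∈)

-- `ExactlyOneTri` asks for equality of positions, whereas the ratio argument yields equality of
-- placements. As xs has no repetitions, the latter implies the former.
lookup-map-unique : ∀ {A B : Set} {f : A → B} {P : B → Set} {xs} → Unique xs →
                    (∀ {x y} → x ∈ xs → y ∈ xs → P (f x) → P (f y) → x ≡ y) →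
                    ∀ i j → P (lookup (List.map f xs) i) → P (lookup (List.map f xs) j) → i ≡ j
lookup-map-unique {f = f} {P} {x ∷ xs} (x∉ ∷ unique) inj = go
  where
  later : ∀ i → P (lookup (List.map f xs) i) → ∃ λ y → y ∈ xs × P (f y)
  later i p with y , y∈ , eq ← ∈-map⁻ f (∈-lookup {xs = List.map f xs} i) = y , y∈ , subst P eq p
  go : ∀ i j → P (lookup (List.map f (x ∷ xs)) i) → P (lookup (List.map f (x ∷ xs)) j) → i ≡ j
  go zero    zero    p q = refl
  go zero    (suc j) p q with y , y∈ , q′ ← later j q =
    contradiction (inj (here refl) (there y∈) p q′) (All.lookup x∉ y∈)
  go (suc i) zero    p q with y , y∈ , p′ ← later i p =
    contradiction (inj (here refl) (there y∈) q p′) (All.lookup x∉ y∈)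
  go (suc i) (suc j) p q = cong suc
    (lookup-map-unique {f = f} {P} unique (λ x∈ y∈ → inj (there x∈) (there y∈)) i j p q)

-- Both placements answer the lookup of the same ratio y / x, so they share the base triangle and p,
-- and the scalar is x / p in both.
side-placement-unique : ∀ {x y} → Independent (x ∷ y ∷ []) → ∀ {s t} → s ∈ placements → t ∈ placements →
                        HasSide (place s) ⟨ x , y ⟩ → HasSide (place t) ⟨ x , y ⟩ → s ≡ t
side-placement-unique {x} {y} ind {g , T} {h , U} s∈ t∈ sideₛ sideₜ =
  let x≢0 = independent⇒≢0ˡ ind
      p , p≢0 , x≡gp , _ , foundₛ =
        scaledFlag-find {g} (proj₂ (∈-placements⁻ s∈)) x≢0 (side⇒flag (scaleTri g T) ind sideₛ)
      q , q≢0 , x≡hq , _ , foundₜ =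
        scaledFlag-find {h} (proj₂ (∈-placements⁻ t∈)) x≢0 (side⇒flag (scaleTri h U) ind sideₜ)
      Tp≡Uq = Maybe.just-injective (trans (sym foundₛ) foundₜ)
      g≡h = begin
        g          ≡⟨ inv-uniqueʳ p≢0 (sym x≡gp) ⟩
        x · inv p  ≡⟨ cong (λ e → x · inv (proj₂ e)) Tp≡Uq ⟩
        x · inv q  ≡⟨ inv-uniqueʳ q≢0 (sym x≡hq) ⟨
        h          ∎
  in cong₂ _,_ g≡h (cong proj₁ Tp≡Uq)

-- 2-dimensional subspaces: groups versus blocks

module _ {x y : F} (ind : Independent (x ∷ y ∷ [])) where

  private
    x≢0 : x ≢ 0V
    x≢0 = independent⇒≢0ˡ ind

  subfieldRatio⇒inGroup : InSubfield64 (y · inv x) → Σ NonZeroF λ i → ⟨ x , y ⟩ ⊆ DesGroup i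
  subfieldRatio⇒inGroup r∈ = (x , x≢0) , contained
    where
    r = y · inv x
    •-·x : ∀ μ z → (μ • z) · x ≡ μ • (z · x)
    •-·x = additive-• {f = _· x} (λ u v → ·-distribʳ u v x)
    -- Both basis vectors are 𝔽₆₄-multiples of x, namely x = s x and y = r x. It is used with s = 1;
    -- a variable s keeps the concrete vector `1F` from being computed with.
    combination : ∀ μ ν s → InSubfield64 s → s · x ≡ x → DesGroup (x , x≢0) ((μ • x) +V (ν • y))
    combination μ ν s s∈ sx≡x = (μ • s) +V (ν • r) ,
      InSubfield64-+ {μ • s} {ν • r} (InSubfield64-• μ {s} s∈) (InSubfield64-• ν {r} r∈) , (begin
      (μ • x) +V (ν • y)                ≡⟨ cong₂ (λ u v → (μ • u) +V (ν • v)) sx≡x (·-cancelʳ x≢0 y) ⟨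
      (μ • (s · x)) +V (ν • (r · x))    ≡⟨ cong₂ _+V_ (•-·x μ s) (•-·x ν r) ⟨
      (μ • s) · x +V (ν • r) · x        ≡⟨ ·-distribʳ (μ • s) (ν • r) x ⟨
      ((μ • s) +V (ν • r)) · x          ∎)
    contained : ⟨ x , y ⟩ ⊆ DesGroup (x , x≢0)
    contained z (μ ∷ ν ∷ [] , eq) = subst (DesGroup (x , x≢0)) (sym (trans eq (lincomb₂ μ ν x y)))
      (combination μ ν 1F InSubfield64-1 (·-identityˡ x))

  -- If x = l z and y = m z, then z cancels and y / x = m / l.
  inGroup⇒subfieldRatio : ∀ i → ⟨ x , y ⟩ ⊆ DesGroup i → InSubfield64 (y · inv x)
  inGroup⇒subfieldRatio (z , _) ⊆G =
    let l , l∈ , x≡lz = ⊆G x (point∈⟨ x , y ⟩ true false)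
        m , m∈ , y≡mz = ⊆G y (point∈⟨ x , y ⟩ false true)
        l≢0 = λ l≡0 → x≢0 (trans x≡lz (trans (cong (_· z) l≡0) (·-zeroˡ z)))
        ratio : y · inv x ≡ m · inv l
        ratio = ratio-· x≢0 (begin
          (m · inv l) · x        ≡⟨ cong ((m · inv l) ·_) x≡lz ⟩
          (m · inv l) · (l · z)  ≡⟨ ·-assoc (m · inv l) l z ⟨
          ((m · inv l) · l) · z  ≡⟨ cong (_· z) (·-cancelʳ l≢0 m) ⟩
          m · z                  ≡⟨ y≡mz ⟨
          y                      ∎)
    in subst InSubfield64 (sym ratio) (InSubfield64-· m∈ (InSubfield64-inv l≢0 l∈))

  subfieldRatio⇒noTri : InSubfield64 (y · inv x) → NoTri blocks ⟨ x , y ⟩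
  subfieldRatio⇒noTri r∈ i side =
    let g , T , _ , T∈ , eq = ∈-blocks⁻ (∈-lookup {xs = blocks} i)
        side′ = subst (λ U → HasSide U ⟨ x , y ⟩) eq side
        _ , _ , _ , r∉ , _ = scaledFlag-find {g} T∈ x≢0 (side⇒flag (scaleTri g T) ind side′)
    in r∉ r∈

  -- The hit supplies the block, the base triangle T scaled by x / p; uniqueness of the placement
  -- makes its position the only one.
  found⇒oneTri : ∀ {e} → find table (y · inv x) ≡ just e → ExactlyOneTri blocks ⟨ x , y ⟩
  found⇒oneTri {T , p} found =
    let T∈ , p≢0 , xy∈ = find-scaledFlag x≢0 found
        gT∈ = ∈-blocks⁺ (·-≢0 x≢0 (inv-≢0 p≢0)) T∈
        side = subst (λ U → HasSide U ⟨ x , y ⟩) (lookup-index gT∈) (flag⇒side (scaleTri (x · inv p) T) xy∈)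
    in Any.index gT∈ , side , λ j side′ → lookup-map-unique {f = place} {λ U → HasSide U ⟨ x , y ⟩}
      placements-unique (side-placement-unique ind) j (Any.index gT∈) side′ side

  -- A hit makes (x, y) a flag of a scaled base triangle, and the finite check puts all ratios of
  -- such flags outside 𝔽₆₄.
  found⇒∉subfield : ∀ {e} → find table (y · inv x) ≡ just e → ¬ InSubfield64 (y · inv x)
  found⇒∉subfield {T , p} found =
    let T∈ , _ , xy∈ = find-scaledFlag x≢0 found
        _ , _ , _ , r∉ , _ = scaledFlag-find {x · inv p} T∈ x≢0 xy∈
    in r∉

TriIndependent-scale : ∀ {g T} → g ≢ 0V → TriIndependent T → TriIndependent (scaleTri g T)
TriIndependent-scale {g} {T} g≢0 ind γ eq = ind γ (·-≡0 g≢0 (trans (·-comm _ g)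
  (trans (additive-lincomb {f = g ·_} (·-distribˡ g) γ (a T ∷ b T ∷ c T ∷ [])) eq)))

blocks-independent : All TriIndependent blocks
blocks-independent = All.tabulate λ T∈ →
  let g , T₀ , g≢0 , T₀∈ , T≡ = ∈-blocks⁻ T∈
  in subst TriIndependent (sym T≡) (TriIndependent-scale g≢0 (All.lookup base-independent T₀∈))

DesGroup-partition : ∀ x → x ≢ 0V →
  Σ NonZeroF (λ i → DesGroup i x) × (∀ i j → DesGroup i x → DesGroup j x → DesGroup i ≐ DesGroup j)
DesGroup-partition x x≢0 = ((x , x≢0) , DesGroup-self (x , x≢0)) , λ i j x∈i x∈j →
  DesGroup-transport {i} {x} x≢0 x∈i j x∈j , DesGroup-transport {j} {x} x≢0 x∈j i x∈i

-- The ratio y / x decides: exhaustiveness of the table says that it lies in 𝔽₆₄ or is found.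
blocks-twoSpaces : ∀ x y → Independent (x ∷ y ∷ []) →
                   (ExactlyOneTri blocks ⟨ x , y ⟩ × (∀ i → ¬ (⟨ x , y ⟩ ⊆ DesGroup i)))
                 ⊎ (NoTri blocks ⟨ x , y ⟩ × Σ NonZeroF (λ i → ⟨ x , y ⟩ ⊆ DesGroup i))
blocks-twoSpaces x y ind = Sum.[ inj₂ ∘ inSubfield , inj₁ ∘ found ]′ (table-exhaustive r)
  where
  r = y · inv x
  inSubfield : r ≡ project₆₄ r → NoTri blocks ⟨ x , y ⟩ × Σ NonZeroF (λ i → ⟨ x , y ⟩ ⊆ DesGroup i)
  inSubfield eq = subfieldRatio⇒noTri {x} {y} ind r∈ , subfieldRatio⇒inGroup {x} {y} ind r∈
    where
    r∈ : InSubfield64 r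
    r∈ = project⇒InSubfield64 {r} eq
  found : (∃ λ e → find table r ≡ just e) →
          ExactlyOneTri blocks ⟨ x , y ⟩ × (∀ i → ¬ (⟨ x , y ⟩ ⊆ DesGroup i))
  found (e , eq) = found⇒oneTri {x} {y} ind {e} eq ,
    λ i ⊆G → found⇒∉subfield {x} {y} ind {e} eq (inGroup⇒subfieldRatio {x} {y} ind i ⊆G)

blocks-isGDTD : IsGDTD 12 6 DesGroup blocks
blocks-isGDTD = record
  { groupDim  = DesGroup-dim
  ; partition = DesGroup-partition
  ; triangles = blocks-independent
  ; twoSpaces = blocks-twoSpaces }

-- Balancedness

module _ {h : F} (h≢0 : h ≢ 0V) where

  InSpan-scale : ∀ {x y z} → ⟨ x , y ⟩ z → ⟨ h · x , h · y ⟩ (h · z)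
  InSpan-scale {x} {y} (γ , refl) = γ , additive-lincomb {f = h ·_} (·-distribˡ h) γ (x ∷ y ∷ [])

  ·-injectiveˡ : ∀ {x y} → h · x ≡ h · y → x ≡ y
  ·-injectiveˡ {x} {y} eq = +V-≡0 (·-≡0 h≢0 (begin
    (x +V y) · h        ≡⟨ ·-comm (x +V y) h ⟩
    h · (x +V y)        ≡⟨ ·-distribˡ h x y ⟩
    h · x +V h · y      ≡⟨ cong (_+V h · y) eq ⟩
    h · y +V h · y      ≡⟨ +V-self (h · y) ⟩
    0V                  ∎))

  InSpan-unscale : ∀ {x y z} → ⟨ h · x , h · y ⟩ (h · z) → ⟨ x , y ⟩ z
  InSpan-unscale {x} {y} (γ , eq) = γ , ·-injectiveˡ
    (trans eq (sym (additive-lincomb {f = h ·_} (·-distribˡ h) γ (x ∷ y ∷ []))))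

  Covers-scale : ∀ T {x} → Covers T x → Covers (scaleTri h T) (h · x)
  Covers-scale T = Sum.map InSpan-scale (Sum.map InSpan-scale InSpan-scale)

  Covers-unscale : ∀ T {x} → Covers (scaleTri h T) (h · x) → Covers T x
  Covers-unscale T = Sum.map InSpan-unscale (Sum.map InSpan-unscale InSpan-unscale)

  private
    shift : F × Tri 12 → F × Tri 12
    shift (g , T) = h · g , T

    shift-injective : ∀ {s t} → shift s ≡ shift t → s ≡ t
    shift-injective eq = cong₂ _,_ (·-injectiveˡ (cong proj₁ eq)) (cong proj₂ eq)

    -- Both lists are free of repetitions and have the same members, so they agree as bags and hence
    -- up to order.
    shift-placements : List.map shift placements ↭ placements
    shift-placements = ∼bag⇒↭ (unique∧set⇒bag (Unique.map⁺ shift-injective placements-unique) placements-unique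
      (mk⇔ to from))
      where
      to : ∀ {s} → s ∈ List.map shift placements → s ∈ placements
      to s∈ =
        let (g , T) , gT∈ , s≡ = ∈-map⁻ shift s∈
            g≢0 , T∈ = ∈-placements⁻ gT∈
        in subst (_∈ placements) (sym s≡) (∈-placements⁺ (·-≢0 h≢0 g≢0) T∈)
      from : ∀ {s} → s ∈ placements → s ∈ List.map shift placements
      -- The preimage of (g, T) under the shift is (g / h, T).
      from {g , T} s∈ =
        let g≢0 , T∈ = ∈-placements⁻ s∈
        in subst (_∈ List.map shift placements)
             (cong (_, T) (trans (·-comm h (g · inv h)) (·-cancelʳ h≢0 g)))
             (∈-map⁺ shift (∈-placements⁺ (·-≢0 g≢0 (inv-≢0 h≢0)) T∈))

  scale-blocks-↭ : List.map (scaleTri h) blocks ↭ blocks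
  scale-blocks-↭ = subst (_↭ blocks) eq (↭-map⁺ place shift-placements)
    where
    eq : List.map place (List.map shift placements) ≡ List.map (scaleTri h) blocks
    eq = begin
      List.map place (List.map shift placements)      ≡⟨ ListProperties.map-∘ placements ⟨
      List.map (place ∘ shift) placements             ≡⟨ ListProperties.map-cong (λ (g , T) → sym (scaleTri-· h g T)) placements ⟩
      List.map (scaleTri h ∘ place) placements        ≡⟨ ListProperties.map-∘ placements ⟩
      List.map (scaleTri h) blocks                    ∎

length-filter-map : ∀ {A B : Set} {P : B → Set} {Q : A → Set} (P? : ∀ y → Dec (P y)) (Q? : ∀ x → Dec (Q x))
                    (f : A → B) → (∀ x → P (f x) → Q x) → (∀ x → Q x → P (f x)) →
                    ∀ xs → length (filter P? (List.map f xs)) ≡ length (filter Q? xs)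
length-filter-map P? Q? f to from [] = refl
length-filter-map P? Q? f to from (x ∷ xs) with P? (f x) | Q? x
... | yes p | yes q = cong suc (length-filter-map P? Q? f to from xs)
... | yes p | no ¬q = contradiction (to x p) ¬q
... | no ¬p | yes q = contradiction (from x q) ¬p
... | no ¬p | no ¬q = length-filter-map P? Q? f to from xs

-- Scaling by h permutes the blocks, so the triangles covering h x may be counted among the scaled
-- blocks h T; and h T covers h x exactly when T covers x.
coverCount-scale : ∀ {h} → h ≢ 0V → ∀ x → coverCount blocks (h · x) ≡ coverCount blocks x
coverCount-scale {h} h≢0 x = begin
  length (filter (covers? (h · x)) blocks)
    ≡⟨ ↭-length (filter-↭ (covers? (h · x)) (scale-blocks-↭ h≢0)) ⟨
  length (filter (covers? (h · x)) (List.map (scaleTri h) blocks))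
    ≡⟨ length-filter-map (covers? (h · x)) (covers? x) (scaleTri h)
         (λ T → Covers-unscale h≢0 T) (λ T → Covers-scale h≢0 T) blocks ⟩
  length (filter (covers? x) blocks) ∎

blocks-balanced : Balanced blocks
-- Every non-zero x is x · 1, so its count is the one at 1, which is never evaluated.
blocks-balanced = coverCount blocks 1F , λ x x≢0 →
  trans (cong (coverCount blocks) (sym (·-identityʳ x))) (coverCount-scale x≢0 1F)

-- Invariance under multiplication by F*

≈T-reflexive : ∀ {n} {T U : Tri n} → T ≡ U → T ≈T U
≈T-reflexive refl = (inj₁ ≐-refl , inj₂ (inj₁ ≐-refl) , inj₂ (inj₂ ≐-refl))
                  , (inj₁ ≐-refl , inj₂ (inj₁ ≐-refl) , inj₂ (inj₂ ≐-refl))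
  where
  ≐-refl : ∀ {n} {S : Pred n} → S ≐ S
  ≐-refl = (λ _ p → p) , (λ _ p → p)

blocks-mulInvariant : MulInvariant blocks
blocks-mulInvariant g g≢0 = forth , back
  where
  forth : ∀ i → Σ (Fin (length blocks)) λ j → lookup blocks j ≈T scaleTri g (lookup blocks i)
  forth i = Any.index T∈ , ≈T-reflexive (sym (lookup-index T∈))
    where T∈ = blocks-scale g≢0 (∈-lookup {xs = blocks} i)
  back : ∀ j → Σ (Fin (length blocks)) λ i → lookup blocks j ≈T scaleTri g (lookup blocks i)
  -- The block U is the g-multiple of g⁻¹ U, which is again a block.
  back j = Any.index T∈ , ≈T-reflexive (begin
    U                                        ≡⟨ scaleTri-1 U ⟨
    scaleTri 1F U                            ≡⟨ cong (λ z → scaleTri z U) (·-inverseʳ g≢0) ⟨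
    scaleTri (g · inv g) U                   ≡⟨ scaleTri-· g (inv g) U ⟨
    scaleTri g (scaleTri (inv g) U)          ≡⟨ cong (scaleTri g) (lookup-index T∈) ⟩
    scaleTri g (lookup blocks (Any.index T∈)) ∎)
    where
    U = lookup blocks j
    T∈ = blocks-scale (inv-≢0 g≢0) (∈-lookup {xs = blocks} j)

theorem3 : Σ (List (Tri 12)) λ B → IsGDTD 12 6 DesGroup B × Balanced B × MulInvariant B
theorem3 = blocks , blocks-isGDTD , blocks-balanced , blocks-mulInvariant
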